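{- $\mathrm{ex}_3(5,\mathcal{B})=5$ and $\mathrm{ex}_3(6,\mathcal{B})=8$; that is, every triple system on $5$ vertices with at least $6$ triples contains a Berge-$K_4$ while some $5$-vertex triple system with $5$ triples does not, and every triple system on $6$ vertices with at least $9$ triples contains a Berge-$K_4$ while some $6$-vertex triple system with $8$ triples does not.
   Context: A triple system is a $3$-uniform hypergraph. A Berge-$K_4$ in a triple system is a configuration consisting of four distinct vertices $v_1,v_2,v_3,v_4$ and six distinct triples $e_{ij}$ ($1\le i<j\le 4$) of the system with $\{v_i,v_j\}\subset e_{ij}$. $\mathcal{B}$ denotes the family of Berge-$K_4$ configurations, and $\mathrm{ex}_3(n,\mathcal{B})$ is the maximum number of triples in a triple system on $n$ vertices containing no Berge-$K_4$. -}

module Defs where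

open import Data.Fin using (Fin; _<_)
open import Data.Fin.Subset using (Subset; ⁅_⁆; _∪_; _⊆_; ∣_∣)
open import Data.List using (List; length)
open import Data.List.Membership.Propositional using (_∈_)
open import Data.List.Relation.Unary.All using (All)
open import Data.List.Relation.Unary.Unique.Propositional using (Unique)
open import Data.Nat using (ℕ; _≤_)
open import Data.Product using (_×_; ∃-syntax)
open import Function.Definitions using (Injective)
open import Relation.Binary.PropositionalEquality using (_≡_)
open import Relation.Nullary using (¬_)

-- The set of triples is a repetition-free list, so that its cardinality is
-- the length of the list; the order of the list plays no role.
record TripleSystem (n : ℕ) : Set where
  field
    triples : List (Subset n)
    unique  : Unique triples
    uniform : All (λ t → ∣ t ∣ ≡ 3) triples

open TripleSystem public

size : ∀ {n} → TripleSystem n → ℕ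
size H = length (triples H)

-- Only the values e i j with i < j are constrained; the others are junk.
record BergeK₄ {n : ℕ} (H : TripleSystem n) : Set where
  field
    v           : Fin 4 → Fin n
    v-injective : Injective _≡_ _≡_ v
    e           : Fin 4 → Fin 4 → Subset n
    e∈H         : ∀ {i j} → i < j → e i j ∈ triples H
    e-distinct  : ∀ {i j k l} → i < j → k < l →
                  e i j ≡ e k l → i ≡ k × j ≡ l
    vᵢvⱼ⊆e      : ∀ {i j} → i < j → ⁅ v i ⁆ ∪ ⁅ v j ⁆ ⊆ e i j

IsMaximum : (ℕ → Set) → ℕ → Set
IsMaximum P m = P m × (∀ k → P k → k ≤ m)

-- ex₃[ n , F ]≡ m states that m is the value of ex₃(n, F), where F H is the
-- type of members of the forbidden family that occur in H.
ex₃[_,_]≡_ : (n : ℕ) → (∀ {n} → TripleSystem n → Set) → ℕ → Set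
ex₃[ n , F ]≡ m =
  IsMaximum (λ k → ∃[ H ] (size {n} H ≡ k × ¬ F H)) m

{-# OPTIONS --safe #-}
-- The lower bounds are structural: a Berge-K₄ uses six distinct triples, and
-- among four vertices of an octahedron two are antipodal, while no face
-- contains an antipodal pair.  The upper bounds are an exhaustive search: decide
-- the triples one after the other, and close a branch as soon as too few
-- triples remain available or the chosen ones contain a Berge-K₄, that is,
-- the six pairs of some four vertices have distinct representatives.
module Submission where

open import Defs
open import Data.Bool using (Bool; true; false; T; not; _∧_; _∨_)
open import Data.Bool.ListAction using (any)
open import Data.Bool.Properties using (T-∧; T-∨; T-≡)
import Data.Bool.Properties as Bool
open import Data.Fin using (Fin; zero; suc; quotient; #_; _<_)
open import Data.Fin.Properties using (_≟_; _<?_; all?; any?; pigeonhole; <⇒≢)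
open import Data.Fin.Subset using (Subset; inside; outside; ∣_∣; ⁅_⁆; _∪_)
import Data.Fin.Subset as Subset
import Data.Fin.Subset.Properties as Subset
open import Data.List
  using (List; []; _∷_; _++_; _ʳ++_; map; length; take; reverse; allFin; tabulate; concatMap)
import Data.List.Membership.DecPropositional as DecMembership
open import Data.List.Membership.Propositional using (_∈_; find)
open import Data.List.Membership.Propositional.Properties
  using (∈-map⁺; ∈-++⁺ˡ; ∈-++⁺ʳ; ∈-∃++; ∈-tabulate⁻)
open import Data.List.Properties using (ʳ++-defn; length-tabulate; length-++)
open import Data.List.Relation.Binary.Permutation.Propositional
  using (_↭_; ↭-sym; ↭⇒↭ₛ)
open import Data.List.Relation.Binary.Permutation.Propositional.Properties
  using (shift; ∈-resp-↭; ↭-length)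
import Data.List.Relation.Binary.Permutation.Setoid.Properties as Permutationₛ
open import Data.List.Relation.Binary.Subset.Propositional using (_⊆_)
open import Data.List.Relation.Unary.All as All using (All; []; _∷_)
import Data.List.Relation.Unary.All.Properties as All
open import Data.List.Relation.Unary.AllPairs as AllPairs using ([]; _∷_)
open import Data.List.Relation.Unary.Any using (here; there)
open import Data.List.Relation.Unary.Any.Properties using (any⁻; map⁻)
open import Data.List.Relation.Unary.Unique.Propositional using (Unique)
import Data.List.Relation.Unary.Unique.Propositional.Properties as Unique
open import Data.Nat using (ℕ; zero; suc; _+_; _≤_; _<ᵇ_; z≤n; s≤s)
import Data.Nat.Properties as ℕ
open import Data.Product using (_×_; _,_; proj₁; proj₂; ∃; ∃-syntax)
open import Data.Product.Properties using (≡-dec; ,-injective)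
open import Data.Sum using (_⊎_; inj₁; inj₂)
open import Data.Vec using (Vec; []; _∷_; lookup)
import Data.Vec as Vec
open import Data.Vec.Properties using (lookup-map; lookup⇒[]=)
import Data.Vec.Properties as Vec
open import Data.Vec.Relation.Binary.Pointwise.Inductive as Pointwise using (Pointwise; []; _∷_)
open import Data.Vec.Relation.Unary.All as Vecᴬ using ([]; _∷_)
import Data.Vec.Relation.Unary.All.Properties as Vecᴬ
open import Data.Vec.Relation.Unary.AllPairs as Vecᴾ using ([]; _∷_)
import Data.Vec.Relation.Unary.Unique.Propositional as Vecᵁ
import Data.Vec.Relation.Unary.Unique.Propositional.Properties as Vecᵁ
open import Function using (_∘_; Equivalence)
open import Relation.Binary.Definitions using (DecidableEquality)
open import Relation.Binary.PropositionalEquality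
  using (_≡_; refl; sym; trans; cong; cong₂; subst; setoid; module ≡-Reasoning)
open import Relation.Nullary using (Dec; ¬_; ¬?; yes; no; contradiction)
open import Relation.Nullary.Decidable using (from-yes; _→-dec_)

private
  variable
    A B : Set
    k m n : ℕ

-- Repetition-free lists under permutation and inclusion.

Unique-resp-↭ : ∀ {xs ys : List A} → xs ↭ ys → Unique xs → Unique ys
Unique-resp-↭ p = Permutationₛ.Unique-resp-↭ (setoid _) (↭⇒↭ₛ p)

Unique-++⁻ˡ : ∀ (xs : List A) {ys} → Unique (xs ++ ys) → Unique xs
Unique-++⁻ˡ []       _            = []
Unique-++⁻ˡ (x ∷ xs) (x∉ ∷ xsys!) = All.++⁻ˡ xs x∉ ∷ Unique-++⁻ˡ xs xsys!

ʳ++-shift : ∀ (x : A) xs ys → xs ʳ++ x ∷ ys ↭ x ∷ xs ʳ++ ys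
ʳ++-shift x xs ys rewrite ʳ++-defn xs {x ∷ ys} | ʳ++-defn xs {ys} = shift x (reverse xs) ys

-- Induction on `xs`: deleting one occurrence of `x` from `ys` keeps the inclusion of the remaining
-- elements, as these differ from `x`.
length-mono-⊆ : ∀ {xs ys : List A} → Unique xs → xs ⊆ ys → length xs ≤ length ys
length-mono-⊆ [] _ = z≤n
length-mono-⊆ {xs = x ∷ xs} (x∉xs ∷ xs!) xs⊆ys with ∈-∃++ (xs⊆ys (here refl))
... | as , bs , refl = subst (suc (length xs) ≤_) (sym (↭-length p))
                         (s≤s (length-mono-⊆ xs! xs⊆rest))
  where
  p = shift x as bs
  xs⊆rest : xs ⊆ as ++ bs
  xs⊆rest z∈xs with ∈-resp-↭ p (xs⊆ys (there z∈xs))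
  ... | here refl = contradiction refl (All.lookup x∉xs z∈xs)
  ... | there z∈  = z∈

_≟ₛ_ : DecidableEquality (Subset n)
_≟ₛ_ = Vec.≡-dec Bool._≟_

_∈?_ : (t : Subset n) (ts : List (Subset n)) → Dec (t ∈ ts)
_∈?_ = DecMembership._∈?_ _≟ₛ_

unique? : (ts : List (Subset n)) → Dec (Unique ts)
unique? = AllPairs.allPairs? (λ s t → ¬? (s ≟ₛ t))

-- Systems of distinct representatives.

module _ (r : A → B → Bool) where

  SDR : Vec A m → List B → Set
  SDR {m} ps ts = ∃ λ (es : Vec B m) →
    Vecᴬ.All (_∈ ts) es × Vecᵁ.Unique es × Pointwise (λ p t → T (r p t)) ps es

  -- pick tries the elements of the second list as representatives of p, the
  -- first list holding those already rejected.
  sdr  : Vec A m → List B → Bool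
  pick : A → Vec A m → List B → List B → Bool
  sdr []       ts = true
  sdr (p ∷ ps) ts = pick p ps [] ts
  pick p ps xs []       = false
  pick p ps xs (t ∷ ts) = r p t ∧ sdr ps (xs ʳ++ ts) ∨ pick p ps (t ∷ xs) ts

  sdr-sound  : ∀ (ps : Vec A m) {ts} → Unique ts → T (sdr ps ts) → SDR ps ts
  pick-sound : ∀ p (ps : Vec A m) xs ts → Unique (xs ʳ++ ts) →
               T (pick p ps xs ts) → SDR (p ∷ ps) (xs ʳ++ ts)
  sdr-sound []       _   _ = [] , [] , [] , []
  sdr-sound (p ∷ ps) ts! h = pick-sound p ps [] _ ts! h
  pick-sound p ps xs (t ∷ ts) ts! h with Equivalence.to T-∨ h
  -- `(t ∷ xs) ʳ++ ts` reduces to `xs ʳ++ t ∷ ts`, so rejecting a candidate leaves the pool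
  -- definitionally the same.
  ... | inj₂ h′ = pick-sound p ps (t ∷ xs) ts ts! h′
  ... | inj₁ h′ = represent (Equivalence.to T-∧ h′) (Unique-resp-↭ σ ts!)
    where
    σ = ʳ++-shift t xs ts
    back : t ∷ xs ʳ++ ts ⊆ xs ʳ++ t ∷ ts
    back = ∈-resp-↭ (↭-sym σ)
    represent : T (r p t) × T (sdr ps (xs ʳ++ ts)) → Unique (t ∷ xs ʳ++ ts) →
                SDR (p ∷ ps) (xs ʳ++ t ∷ ts)
    represent (rpt , h″) (t∉rest ∷ rest!) with sdr-sound ps rest! h″
    ... | es , es∈ , es! , rep =
      t ∷ es , back (here refl) ∷ Vecᴬ.map (back ∘ there) es∈ ,
      Vecᴬ.map (All.lookup t∉rest) es∈ ∷ es! , rpt ∷ rep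

-- The six edges of K₄ and their representatives.

edges : Vec (Fin 4 × Fin 4) 6
edges = (# 0 , # 1) ∷ (# 0 , # 2) ∷ (# 0 , # 3) ∷ (# 1 , # 2) ∷ (# 1 , # 3) ∷ (# 2 , # 3) ∷ []

edges-< : ∀ l → proj₁ (lookup edges l) < proj₂ (lookup edges l)
edges-< = from-yes (all? λ l → proj₁ (lookup edges l) <? proj₂ (lookup edges l))

edges-injective : ∀ l l′ → lookup edges l ≡ lookup edges l′ → l ≡ l′
edges-injective = from-yes (all? λ l → all? λ l′ →
  ≡-dec _≟_ _≟_ (lookup edges l) (lookup edges l′) →-dec l ≟ l′)

-- Kept abstract, as it would otherwise unfold to the whole decision procedure.
abstract
  edge-index : ∀ i j → ∃ λ l → i < j → lookup edges l ≡ (i , j)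
  edge-index = from-yes (all? λ i → all? λ j → any? λ l →
    i <? j →-dec ≡-dec _≟_ _≟_ (lookup edges l) (i , j))

bergeK₄⇒6≤size : {H : TripleSystem n} → BergeK₄ H → 6 ≤ size H
bergeK₄⇒6≤size {H = H} K = subst (_≤ size H) (length-tabulate f)
  (length-mono-⊆ (Unique.tabulate⁺ f-injective) f⊆H)
  where
  open BergeK₄ K
  f : Fin 6 → Subset _
  f l = e (proj₁ (lookup edges l)) (proj₂ (lookup edges l))
  f-injective : ∀ {l l′} → f l ≡ f l′ → l ≡ l′
  f-injective {l} {l′} eq with e-distinct (edges-< l) (edges-< l′) eq
  ... | i≡i′ , j≡j′ = edges-injective l l′ (cong₂ _,_ i≡i′ j≡j′)
  f⊆H : tabulate f ⊆ triples H
  f⊆H t∈f with ∈-tabulate⁻ {f = f} t∈f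
  ... | l , refl = e∈H (edges-< l)

endpoints : Vec A 4 → Fin 4 × Fin 4 → A × A
endpoints v (i , j) = lookup v i , lookup v j

pairs : Vec A 4 → Vec (A × A) 6
pairs v = Vec.map (endpoints v) edges

contains : Fin n × Fin n → Subset n → Bool
contains (a , b) t = lookup t a ∧ lookup t b

contains⇒⊆ : ∀ (a b : Fin n) t → T (contains (a , b) t) → ⁅ a ⁆ ∪ ⁅ b ⁆ Subset.⊆ t
contains⇒⊆ a b t h x∈ with Equivalence.to (T-∧ {lookup t a}) h | Subset.x∈p∪q⁻ ⁅ a ⁆ ⁅ b ⁆ x∈
... | a∈t , _ | inj₁ x∈a rewrite Subset.x∈⁅y⁆⇒x≡y a x∈a = lookup⇒[]= a t (Equivalence.to T-≡ a∈t)
... | _ , b∈t | inj₂ x∈b rewrite Subset.x∈⁅y⁆⇒x≡y b x∈b = lookup⇒[]= b t (Equivalence.to T-≡ b∈t)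

-- The representative of the pair of `v i` and `v j` serves as `e i j`. Equal representatives have
-- equal indices, and an index determines its edge.
sdr⇒bergeK₄ : (H : TripleSystem n) {v : Vec (Fin n) 4} → Vecᵁ.Unique v →
              SDR contains (pairs v) (triples H) → BergeK₄ H
sdr⇒bergeK₄ H {v} v! (es , es∈H , es! , rep) = record
  { v           = lookup v
  ; v-injective = Vecᵁ.lookup-injective v! _ _
  -- A value is due for all `i` and `j`; `edge-index` supplies one also when `i < j` fails, its
  -- implication then being vacuous.
  ; e           = λ i j → lookup es (index i j)
  ; e∈H         = λ _ → Vecᴬ.lookup⁺ es∈H _
  ; e-distinct  = λ {i} {j} {k} {l} i<j k<l eq → ,-injective (begin
      (i , j)                    ≡⟨ proj₂ (edge-index i j) i<j ⟨
      lookup edges (index i j)   ≡⟨ cong (lookup edges) (Vecᵁ.lookup-injective es! _ _ eq) ⟩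
      lookup edges (index k l)   ≡⟨ proj₂ (edge-index k l) k<l ⟩
      (k , l)                    ∎)
  ; vᵢvⱼ⊆e      = λ {i} {j} i<j → contains⇒⊆ _ _ _
      (subst (λ p → T (contains p (lookup es (index i j)))) (pairs-index i<j)
             (Pointwise.lookup rep (index i j)))
  }
  where
  open ≡-Reasoning
  index : Fin 4 → Fin 4 → Fin 6
  index i j = proj₁ (edge-index i j)
  pairs-index : ∀ {i j} → i < j → lookup (pairs v) (index i j) ≡ endpoints v (i , j)
  pairs-index {i} {j} i<j =
    trans (lookup-map (index i j) (endpoints v) edges)
          (cong (endpoints v) (proj₂ (edge-index i j) i<j))

-- Enumeration of cores and triples, and the search over them.

choose : ∀ k → List A → List (Vec A k)
choose zero    xs       = [] ∷ []
choose (suc k) []       = []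
choose (suc k) (x ∷ xs) = map (x ∷_) (choose k xs) ++ choose (suc k) xs

subsets : ∀ n → ℕ → List (Subset n)
subsets zero    zero    = [] ∷ []
subsets zero    (suc k) = []
subsets (suc n) zero    = map (outside ∷_) (subsets n zero)
subsets (suc n) (suc k) = map (inside ∷_) (subsets n k) ++ map (outside ∷_) (subsets n (suc k))

∈-subsets : ∀ (s : Subset n) → s ∈ subsets n ∣ s ∣
∈-subsets []            = here refl
∈-subsets (inside ∷ s)  = ∈-++⁺ˡ (∈-map⁺ _ (∈-subsets s))
-- `subsets (suc n)` reduces only at a size in constructor form, hence the case split on `∣ s ∣`.
∈-subsets (outside ∷ s) with ∣ s ∣ | ∈-subsets s
... | zero  | s∈ = ∈-map⁺ _ s∈
... | suc k | s∈ = ∈-++⁺ʳ (map (inside ∷_) (subsets _ k)) (∈-map⁺ _ s∈)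

-- Each set of four vertices is listed once, in increasing order, since renumbering its vertices
-- does not affect whether it is the core of a Berge-K₄.
cores : ∀ n → List (Vec (Fin n) 4)
cores n = choose 4 (allFin n)

-- C lists the pairs of each core, P the chosen triples and R the undecided ones.
-- C is a parameter so that its evaluation is shared between all calls.
module Search (C : List (Vec (Fin n × Fin n) 6)) (k : ℕ) where

  berge : List (Subset n) → Bool
  berge P = any (λ ps → sdr contains ps P) C

  search : List (Subset n) → List (Subset n) → Bool
  search P []      = length P <ᵇ k
  search P (t ∷ R) = (length P + length (t ∷ R) <ᵇ k)
                   -- Only the branch that takes `t` is tested for a Berge-K₄, as the other one
                   -- leaves `P` unchanged.
                   ∨ (berge (t ∷ P) ∨ search (t ∷ P) R) ∧ search P R

-- Soundness of the search.

module _ {vs : List (Vec (Fin n) 4)} (vs! : All Vecᵁ.Unique vs)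
         (H : TripleSystem n) (k≤H : k ≤ size H) where

  open Search (map pairs vs) k

  berge-sound : ∀ {P} → Unique P → P ⊆ triples H → T (berge P) → BergeK₄ H
  berge-sound {P} P! P⊆H h with find (map⁻ (any⁻ _ (map pairs vs) h))
  ... | v , v∈vs , h′ with sdr-sound contains (pairs v) P! h′
  ... | es , es∈P , rest = sdr⇒bergeK₄ H (All.lookup vs! v∈vs) (es , Vecᴬ.map P⊆H es∈P , rest)

  -- The list of triples of `H` is repetition-free, has at least `k` entries and lies in `P ++ R`,
  -- which therefore has at least `k` entries too.
  too-small : ∀ P R → triples H ⊆ P ++ R → ¬ T (length P + length R <ᵇ k)
  too-small P R H⊆ h = ℕ.<⇒≱ (ℕ.<ᵇ⇒< _ _ h) (ℕ.≤-trans k≤H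
    (subst (size H ≤_) (length-++ P) (length-mono-⊆ (unique H) H⊆)))

  -- The induction follows the one branch that `H` determines, taking `t` exactly when it belongs to
  -- `H`. The chosen triples then stay inside `H`, and `H` inside the chosen and undecided ones.
  -- Such a branch never closes for lack of triples, so it closes with a Berge-K₄.
  search-sound : ∀ P R → Unique (P ++ R) → P ⊆ triples H → triples H ⊆ P ++ R →
                 T (search P R) → BergeK₄ H
  search-sound P [] _ _ H⊆ h = contradiction
    (subst (λ l → T (l <ᵇ k)) (sym (ℕ.+-identityʳ _)) h) (too-small P [] H⊆)
  search-sound P (t ∷ R) PtR! P⊆H H⊆ h with Equivalence.to T-∨ h
  ... | inj₁ h′ = contradiction h′ (too-small P (t ∷ R) H⊆)
  ... | inj₂ h′ with Equivalence.to T-∧ h′ | t ∈? triples H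
  ...   | with-t , _ | yes t∈H = cases (Equivalence.to T-∨ with-t)
    where
    σ = shift t P R
    tPR! = Unique-resp-↭ σ PtR!
    tP⊆H : t ∷ P ⊆ triples H
    tP⊆H (here refl) = t∈H
    tP⊆H (there s∈P) = P⊆H s∈P
    cases : T (berge (t ∷ P)) ⊎ T (search (t ∷ P) R) → BergeK₄ H
    cases (inj₁ b) = berge-sound (Unique-++⁻ˡ (t ∷ P) tPR!) tP⊆H b
    cases (inj₂ s) = search-sound (t ∷ P) R tPR! tP⊆H (∈-resp-↭ σ ∘ H⊆) s
  ...   | _ , without-t | no t∉H =
    search-sound P R (AllPairs.tail (Unique-resp-↭ σ PtR!)) P⊆H H⊆PR without-t
    where
    σ = shift t P R
    H⊆PR : triples H ⊆ P ++ R
    H⊆PR s∈H with ∈-resp-↭ σ (H⊆ s∈H)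
    ... | here refl = contradiction s∈H t∉H
    ... | there s∈  = s∈

-- By uniformity all triples of `H` occur in `subsets n 3`, so the invariant of the search holds at
-- its root, where nothing is decided.
full⇒bergeK₄ : All Vecᵁ.Unique (cores n) → Unique (subsets n 3) →
               Search.search (map pairs (cores n)) k [] (subsets n 3) ≡ true →
               (H : TripleSystem n) → k ≤ size H → BergeK₄ H
full⇒bergeK₄ cores! subsets! found H k≤H =
  search-sound cores! H k≤H [] _ subsets! (λ ()) H⊆ (Equivalence.from T-≡ found)
  where
  H⊆ : triples H ⊆ subsets _ 3
  H⊆ {t} t∈H = subst (λ l → t ∈ subsets _ l) (All.lookup (uniform H) t∈H) (∈-subsets t)

-- Upper bounds by evaluation.

uniqueVecs? : (vs : List (Vec (Fin n) 4)) → Dec (All Vecᵁ.Unique vs)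
uniqueVecs? = All.all? (Vecᴾ.allPairs? λ a b → ¬? (a ≟ b))

-- The thresholds 6 here and 9 below are one above the claimed maxima; `refl` makes the type checker
-- run the search.
search₅ : Search.search (map pairs (cores 5)) 6 [] (subsets 5 3) ≡ true
search₅ = refl

search₆ : Search.search (map pairs (cores 6)) 9 [] (subsets 6 3) ≡ true
search₆ = refl

6≤size⇒bergeK₄ : (H : TripleSystem 5) → 6 ≤ size H → BergeK₄ H
6≤size⇒bergeK₄ = full⇒bergeK₄
  (from-yes (uniqueVecs? (cores 5))) (from-yes (unique? (subsets 5 3))) search₅

9≤size⇒bergeK₄ : (H : TripleSystem 6) → 9 ≤ size H → BergeK₄ H
9≤size⇒bergeK₄ = full⇒bergeK₄
  (from-yes (uniqueVecs? (cores 6))) (from-yes (unique? (subsets 6 3))) search₆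

-- Extremal systems on five and six vertices.

fiveTriples : TripleSystem 5
fiveTriples = record
  -- Any five triples would do, being fewer than the six that a Berge-K₄ uses.
  { triples = take 5 (subsets 5 3)
  ; unique  = from-yes (unique? (take 5 (subsets 5 3)))
  ; uniform = refl ∷ refl ∷ refl ∷ refl ∷ refl ∷ []
  }

fiveTriples-free : ¬ BergeK₄ fiveTriples
fiveTriples-free K = ℕ.n≮n 5 (bergeK₄⇒6≤size K)

-- The antipodal pairs are {0,1}, {2,3} and {4,5}, the fibres of quotient 2.
faces : List (Subset 6)
faces = concatMap (λ x → concatMap (λ y → map (face x y) sides) sides) sides
  where
  sides = inside ∷ outside ∷ []
  face : Bool → Bool → Bool → Subset 6
  face x y z = x ∷ not x ∷ y ∷ not y ∷ z ∷ not z ∷ []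

octahedron : TripleSystem 6
octahedron = record
  { triples = faces
  ; unique  = from-yes (unique? faces)
  ; uniform = from-yes (All.all? (λ t → ∣ t ∣ ℕ.≟ 3) faces)
  }

axis : Fin 6 → Fin 3
axis = quotient 2

faces-transversal :
  All (λ t → ∀ a b → a Subset.∈ t → b Subset.∈ t → axis a ≡ axis b → a ≡ b) faces
faces-transversal = from-yes (All.all? (λ t → all? λ a → all? λ b →
  a Subset.∈? t →-dec b Subset.∈? t →-dec axis a ≟ axis b →-dec a ≟ b) faces)

octahedron-free : ¬ BergeK₄ octahedron
-- Four core vertices lie on three axes, so some `v i` and `v j` share one. The face `e i j`
-- contains both, which forces them to be equal.
octahedron-free K with pigeonhole (ℕ.n<1+n 3) (axis ∘ v)
  where open BergeK₄ K
... | i , j , i<j , eq = <⇒≢ i<j (v-injective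
  (All.lookup faces-transversal (e∈H i<j) (v i) (v j)
    (vᵢvⱼ⊆e i<j (Subset.x∈p∪q⁺ (inj₁ (Subset.x∈⁅x⁆ (v i)))))
    (vᵢvⱼ⊆e i<j (Subset.x∈p∪q⁺ (inj₂ (Subset.x∈⁅x⁆ (v j))))) eq))
  where open BergeK₄ K

free⇒size≤ : (∀ (H : TripleSystem n) → suc m ≤ size H → BergeK₄ H) →
             ∀ k → ∃[ H ] (size {n} H ≡ k × ¬ BergeK₄ H) → k ≤ m
free⇒size≤ full _ (H , refl , free) = ℕ.≮⇒≥ (free ∘ full H)

theorem2 : (ex₃[ 5 , BergeK₄ ]≡ 5 × ex₃[ 6 , BergeK₄ ]≡ 8)
    × (∀ (H : TripleSystem 5) → 6 ≤ size H → BergeK₄ H)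
    × (∃[ H ] (size {5} H ≡ 5 × ¬ BergeK₄ H))
    × (∀ (H : TripleSystem 6) → 9 ≤ size H → BergeK₄ H)
    × (∃[ H ] (size {6} H ≡ 8 × ¬ BergeK₄ H))
theorem2 =
  ((five , free⇒size≤ 6≤size⇒bergeK₄) , (eight , free⇒size≤ 9≤size⇒bergeK₄)) ,
  6≤size⇒bergeK₄ , five , 9≤size⇒bergeK₄ , eight
  where
  five  = fiveTriples , refl , fiveTriples-free
  eight = octahedron , refl , octahedron-free
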